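{- Let $A$ be a bounded distributive lattice, $X$ its Priestley space, and $\kappa$ a regular cardinal. Then every existing join of fewer than $\kappa$ elements in $A$ is distributive if and only if for each $\kappa$-clopen upset $U$ of $X$ such that ${\sf cl_2}(U)$ is clopen, we have ${\sf cl_2}(U)={\sf cl}(U)$.
   Context: A join $\bigvee S$ is distributive if $a\wedge\bigvee S=\bigvee\{a\wedge s:s\in S\}$ for all $a$. The Priestley space $X$ of $A$ is the set of prime filters ordered by inclusion, with topology generated by $\{\mathfrak s(a)\setminus\mathfrak s(b)\}$, $\mathfrak s(a)=\{x:a\in x\}$; $\mathfrak s$ is an isomorphism of $A$ onto the lattice of clopen upsets. ${\sf cl}$ is topological closure and ${\sf cl_2}(S)={\uparrow}{\sf cl}(S)$ (closure in the topology of open downsets). A $\kappa$-clopen upset is a union of fewer than $\kappa$ clopen upsets. -}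

module Defs where

open import Axiom.ExcludedMiddle using (ExcludedMiddle)
open import Data.List.Base using (List)
open import Data.List.Relation.Unary.All using (All)
open import Data.Nat.Base using (ℕ)
open import Data.Product.Base using (Σ; Σ-syntax; ∃; _×_; _,_)
open import Data.Sum.Base using (_⊎_)
open import Function.Bundles using (_↣_)
open import Level using (Level; Setω; _⊔_; suc)
open import Relation.Binary.Bundles using (Poset)
open import Relation.Binary.Definitions using (Maximum; Minimum)
open import Relation.Binary.Lattice.Bundles using (DistributiveLattice)
open import Relation.Nullary.Negation using (¬_)
open import Relation.Unary using (Pred; _∈_; _⊆_; _≐_; ∁; ⋃; _≬_)

private
  variable
    x j b u : Level

-- The set theory in which Priestley duality lives (ZFC) is made explicit as
-- two hypotheses: excluded middle and Zorn's lemma, at every level.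

module _ {c ℓ₁ ℓ₂ : Level} (P : Poset c ℓ₁ ℓ₂) where
  open Poset P

  IsChain : {p : Level} → Pred Carrier p → Set (c ⊔ ℓ₂ ⊔ p)
  IsChain C = ∀ {s t} → s ∈ C → t ∈ C → s ≤ t ⊎ t ≤ s

  HasUpperBound : {p : Level} → Pred Carrier p → Set (c ⊔ ℓ₂ ⊔ p)
  HasUpperBound C = ∃ λ m → ∀ {s} → s ∈ C → s ≤ m

  IsMaximal : Carrier → Set (c ⊔ ℓ₁ ⊔ ℓ₂)
  IsMaximal m = ∀ {s} → m ≤ s → m ≈ s

-- The empty chain has an upper bound too, so P is nonempty.
ZornsLemma : (c ℓ₁ ℓ₂ : Level) → Set (suc (c ⊔ ℓ₁ ⊔ ℓ₂))
ZornsLemma c ℓ₁ ℓ₂ =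
  (P : Poset c ℓ₁ ℓ₂) →
  ((C : Pred (Poset.Carrier P) (c ⊔ ℓ₁ ⊔ ℓ₂)) → IsChain P C → HasUpperBound P C) →
  ∃ λ m → IsMaximal P m

record ClassicalLogicWithChoice : Setω where
  field
    excludedMiddle : {ℓ : Level} → ExcludedMiddle ℓ
    zornsLemma     : {c ℓ₁ ℓ₂ : Level} → ZornsLemma c ℓ₁ ℓ₂

-- A cardinal is given by a type K having that cardinality, and cardinals are
-- compared by injections; |I| < |K| is I ≺ K.

infix 4 _≺_

_≺_ : {i k : Level} → Set i → Set k → Set (i ⊔ k)
I ≺ K = (I ↣ K) × ¬ (K ↣ I)

-- Regular: infinite, and a sum of fewer than κ cardinals, each less than κ,
-- is less than κ.  Every cardinal below |K| is that of a type in Set k.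
record IsRegular {k : Level} (K : Set k) : Set (suc k) where
  field
    infinite : ℕ ↣ K
    regular  : (I : Set k) (J : I → Set k) →
               I ≺ K → (∀ i → J i ≺ K) → Σ I J ≺ K

record BoundedDistributiveLattice (c ℓ₁ ℓ₂ : Level) : Set (suc (c ⊔ ℓ₁ ⊔ ℓ₂)) where
  field
    distributiveLattice : DistributiveLattice c ℓ₁ ℓ₂

  open DistributiveLattice distributiveLattice public

  field
    ⊤       : Carrier
    ⊥       : Carrier
    maximum : Maximum _≤_ ⊤
    minimum : Minimum _≤_ ⊥

-- Openness in the topology generated by the subbase B: each point of U lies in
-- a finite intersection of subbasic sets contained in U (the empty list gives
-- the whole space).
GeneratedOpen : {X : Set x} {J : Set j} → (J → Pred X b) → Pred X u → Set (x ⊔ j ⊔ b ⊔ u)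
GeneratedOpen {X = X} {J = J} B U =
  ∀ {p} → p ∈ U → Σ[ js ∈ List J ] (p ∈ ⋂B js × ⋂B js ⊆ U)
  where
  ⋂B : List J → Pred X _
  ⋂B js q = All (λ i → q ∈ B i) js

module _ {c ℓ₁ ℓ₂ : Level} (A : BoundedDistributiveLattice c ℓ₁ ℓ₂) where
  open BoundedDistributiveLattice A

  -- m is the join of the set { a i : i ∈ I }; a set with fewer than κ elements
  -- is given as such a family with I ≺ K.
  record IsJoin {i : Level} {I : Set i} (a : I → Carrier) (m : Carrier)
                : Set (c ⊔ ℓ₂ ⊔ i) where
    field
      upper : ∀ i → a i ≤ m
      least : ∀ {n} → (∀ i → a i ≤ n) → m ≤ n

  -- For m the join of the family s.
  IsDistributiveJoin : {i : Level} {I : Set i} → (I → Carrier) → Carrier →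
                       Set (c ⊔ ℓ₂ ⊔ i)
  IsDistributiveJoin s m = ∀ a → IsJoin (λ i → a ∧ s i) (a ∧ m)

  record PrimeFilter : Set (suc (c ⊔ ℓ₁ ⊔ ℓ₂)) where
    field
      member   : Pred Carrier (c ⊔ ℓ₁ ⊔ ℓ₂)
      ⊤-member : ⊤ ∈ member
      ∧-closed : ∀ {a b} → a ∈ member → b ∈ member → a ∧ b ∈ member
      upward   : ∀ {a b} → a ≤ b → a ∈ member → b ∈ member
      proper   : ¬ (⊥ ∈ member)
      prime    : ∀ {a b} → a ∨ b ∈ member → a ∈ member ⊎ b ∈ member

  open PrimeFilter

  -- Points of the Priestley space are identified when they have the same
  -- members; all open sets and all upsets respect this identification.
  _⊑_ : PrimeFilter → PrimeFilter → Set (c ⊔ ℓ₁ ⊔ ℓ₂)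
  p ⊑ q = member p ⊆ member q

  𝔰 : Carrier → Pred PrimeFilter (c ⊔ ℓ₁ ⊔ ℓ₂)
  𝔰 a p = a ∈ member p

  subbasic : Carrier × Carrier → Pred PrimeFilter (c ⊔ ℓ₁ ⊔ ℓ₂)
  subbasic (a , b) p = p ∈ 𝔰 a × ¬ (p ∈ 𝔰 b)

  IsOpen : Pred PrimeFilter u → Set (suc (c ⊔ ℓ₁ ⊔ ℓ₂) ⊔ u)
  IsOpen = GeneratedOpen subbasic

  IsClopen : Pred PrimeFilter u → Set (suc (c ⊔ ℓ₁ ⊔ ℓ₂) ⊔ u)
  IsClopen U = IsOpen U × IsOpen (∁ U)

  IsUpset : Pred PrimeFilter u → Set (suc (c ⊔ ℓ₁ ⊔ ℓ₂) ⊔ u)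
  IsUpset U = ∀ {p q} → p ⊑ q → p ∈ U → q ∈ U

  ↑ : Pred PrimeFilter u → Pred PrimeFilter (suc (c ⊔ ℓ₁ ⊔ ℓ₂) ⊔ u)
  ↑ U q = ∃ λ p → p ∈ U × p ⊑ q

  -- The open neighbourhoods V range over one level, which is that of the
  -- basic open sets and hence large enough.
  cl : Pred PrimeFilter u → Pred PrimeFilter (suc (c ⊔ ℓ₁ ⊔ ℓ₂) ⊔ u)
  cl U p = (V : Pred PrimeFilter (c ⊔ ℓ₁ ⊔ ℓ₂)) → IsOpen V → p ∈ V → V ≬ U

  cl₂ : Pred PrimeFilter u → Pred PrimeFilter (suc (c ⊔ ℓ₁ ⊔ ℓ₂) ⊔ u)
  cl₂ U = ↑ (cl U)

  record IsκClopenUpset {k : Level} (K : Set k) (U : Pred PrimeFilter u)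
                        : Set (suc (c ⊔ ℓ₁ ⊔ ℓ₂ ⊔ k) ⊔ u) where
    field
      Index   : Set k
      small   : Index ≺ K
      piece   : Index → Pred PrimeFilter (c ⊔ ℓ₁ ⊔ ℓ₂)
      clopen  : ∀ i → IsClopen (piece i)
      upset   : ∀ i → IsUpset (piece i)
      isUnion : U ≐ ⋃ Index piece

{-# OPTIONS --safe #-}

-- A point q lies in the closure of C iff it respects the preorder a ⊳ b,
-- "every r ∈ C containing a contains b".  A filter that is maximal among those
-- avoiding a ⊳-lower ideal is prime and respects ⊳, so Zorn's lemma yields
-- points of cl C directly.  This gives that every clopen upset is some 𝔰 a, and
-- that cl₂ (⋃ 𝔰 (s i)) = 𝔰 m when m is the join of s.  Membership of 𝔰 m in
-- cl (⋃ 𝔰 (s i)) then says exactly that a ∧ s i ≤ b for all i implies a ∧ m ≤ b.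
module Submission where

open import Defs
open import Data.List.Base using ([]; _∷_)
open import Data.List.Relation.Unary.All using (All; []; _∷_)
open import Data.Product.Base using (∃; _×_; _,_; proj₁; proj₂; map₂)
open import Data.Sum.Base using (inj₁; inj₂; [_,_]′)
open import Function.Base using (id; _∘_)
open import Function.Bundles using (_⇔_; mk⇔)
open import Level using (Level; Lift; lift; lower; _⊔_; suc)
open import Relation.Binary.Bundles using (Poset)
import Relation.Binary.Lattice.Properties.DistributiveLattice as DistributiveLatticeProperties
import Relation.Binary.Lattice.Properties.JoinSemilattice as JoinSemilatticeProperties
import Relation.Binary.Lattice.Properties.MeetSemilattice as MeetSemilatticeProperties
open import Relation.Nullary.Decidable using (yes; no; True; toWitness; fromWitness; decidable-stable)
open import Relation.Nullary.Negation using (¬_; contradiction)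
open import Relation.Unary using (Pred; _∈_; _∉_; _⊆_; _≐_; ∁; ⋃)

private
  variable
    b f i j u v w : Level

GeneratedOpen-resp-≐ : {X : Set i} {J : Set j} {B : J → Pred X b} {U : Pred X u} {V : Pred X v} →
                       U ≐ V → GeneratedOpen B U → GeneratedOpen B V
GeneratedOpen-resp-≐ (U⊆V , V⊆U) openU p∈V with openU (V⊆U p∈V)
... | js , p∈js , js⊆U = js , p∈js , U⊆V ∘ js⊆U

module _ (classical : ClassicalLogicWithChoice) where
  open ClassicalLogicWithChoice classical

  -- Classical reasoning and change of universe level.

  by-contradiction : {P : Set i} → ¬ ¬ P → P
  by-contradiction = decidable-stable excludedMiddle

  -- `True` of a decision lives at level zero, so excluded middle gives every proposition an
  -- equivalent at any level `ℓ`. Bounds of chains of filters use this to return to the level `L` of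
  -- prime filters.
  Resize : (ℓ : Level) → Set i → Set ℓ
  Resize ℓ P = Lift ℓ (True (excludedMiddle {P = P}))

  resize : {P : Set i} → P → Resize j P
  resize p = lift (fromWitness p)

  unresize : {P : Set i} → Resize j P → P
  unresize r = toWitness (lower r)

  module _ {c ℓ₁ ℓ₂ : Level} (A : BoundedDistributiveLattice c ℓ₁ ℓ₂) where
    open BoundedDistributiveLattice A
    open DistributiveLatticeProperties distributiveLattice using (∧-distribʳ-∨)
    open JoinSemilatticeProperties joinSemilattice using (∨-monotonic)
    open MeetSemilatticeProperties meetSemilattice using (∧-monotonic)
    open PrimeFilter
    open IsJoin

    private
      L : Level
      L = c ⊔ ℓ₁ ⊔ ℓ₂

      X : Set (suc L)
      X = PrimeFilter A

    -- Filters and ideals.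

    record IsFilter (F : Pred Carrier f) : Set (c ⊔ ℓ₂ ⊔ f) where
      field
        ⊤-member : ⊤ ∈ F
        ∧-closed : ∀ {a b} → a ∈ F → b ∈ F → a ∧ b ∈ F
        upward   : ∀ {a b} → a ≤ b → a ∈ F → b ∈ F

    record IsIdeal (J : Pred Carrier j) : Set (c ⊔ ℓ₂ ⊔ j) where
      field
        ⊥-member : ⊥ ∈ J
        ∨-closed : ∀ {a b} → a ∈ J → b ∈ J → a ∨ b ∈ J
        downward : ∀ {a b} → a ≤ b → b ∈ J → a ∈ J

    principalFilter : ∀ a → IsFilter (a ≤_)
    principalFilter a = record
      { ⊤-member = maximum a
      ; ∧-closed = ∧-greatest
      ; upward   = λ x≤y a≤x → trans a≤x x≤y
      }

    principalIdeal : ∀ a → IsIdeal (_≤ a)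
    principalIdeal a = record
      { ⊥-member = minimum a
      ; ∨-closed = ∨-least
      ; downward = trans
      }

    member-isFilter : (p : X) → IsFilter (member p)
    member-isFilter p = record
      { ⊤-member = ⊤-member p
      ; ∧-closed = ∧-closed p
      ; upward   = upward p
      }

    nonmember-isIdeal : (p : X) → IsIdeal (λ a → ¬ (a ∈ member p))
    nonmember-isIdeal p = record
      { ⊥-member = proper p
      ; ∨-closed = λ a∉p b∉p → [ a∉p , b∉p ]′ ∘ prime p
      ; downward = λ a≤b b∉p → b∉p ∘ upward p a≤b
      }

    -- Prime filters from maximal filters avoiding an ideal.

    module _ {F : Pred Carrier f} {J : Pred Carrier j}
             (isFilter : IsFilter F) (isIdeal : IsIdeal J)
             (F∩J=∅ : ∀ {a} → a ∈ F → a ∉ J) where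
      private
        module F = IsFilter isFilter
        module J = IsIdeal isIdeal

      record FilterAvoiding : Set (suc L ⊔ f ⊔ j) where
        field
          member   : Pred Carrier L
          filter   : IsFilter member
          contains : F ⊆ member
          avoids   : ∀ {a} → a ∈ member → a ∉ J

        open IsFilter filter public

      module G = FilterAvoiding

      filterPoset : Poset (suc L ⊔ f ⊔ j) L L
      filterPoset = record
        { Carrier = FilterAvoiding
        ; _≈_ = λ G H → G.member G ≐ G.member H
        ; _≤_ = λ G H → G.member G ⊆ G.member H
        ; isPartialOrder = record
          { isPreorder = record
            { isEquivalence = record
              { refl  = id , id
              ; sym   = λ (l , r) → r , l
              ; trans = λ (l , r) (l′ , r′) → l′ ∘ l , r ∘ r′
              }
            ; reflexive = proj₁
            ; trans = λ l l′ → l′ ∘ l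
            }
          ; antisym = λ l r → l , r
          }
        }

      -- A nonempty chain is bounded by its union. The empty union would not contain `F`, so the
      -- empty chain is bounded by `F` itself.
      chain-bounded : (C : Pred FilterAvoiding (suc L ⊔ f ⊔ j)) →
                      IsChain filterPoset C → HasUpperBound filterPoset C
      chain-bounded C chain with excludedMiddle {P = ∃ C}
      ... | no empty = bound , λ {G} G∈C → contradiction (G , G∈C) empty
        where
        bound : FilterAvoiding
        bound = record
          { member = λ a → Resize L (a ∈ F)
          ; filter = record
            { ⊤-member = resize F.⊤-member
            ; ∧-closed = λ x y → resize (F.∧-closed (unresize x) (unresize y))
            ; upward   = λ a≤b x → resize (F.upward a≤b (unresize x))
            }
          ; contains = resize
          ; avoids   = F∩J=∅ ∘ unresize
          }
      ... | yes (G₀ , G₀∈C) = bound , λ {G} G∈C a∈G → resize (G , G∈C , a∈G)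
        where
        Union : Pred Carrier (suc L ⊔ f ⊔ j)
        Union a = ∃ λ G → G ∈ C × a ∈ G.member G

        union-∧ : ∀ {a b} → a ∈ Union → b ∈ Union → a ∧ b ∈ Union
        union-∧ (G , G∈C , a∈G) (H , H∈C , b∈H) with chain G∈C H∈C
        ... | inj₁ G≤H = H , H∈C , G.∧-closed H (G≤H a∈G) b∈H
        ... | inj₂ H≤G = G , G∈C , G.∧-closed G a∈G (H≤G b∈H)

        union-avoids : ∀ {a} → a ∈ Union → a ∉ J
        union-avoids (G , _ , a∈G) = G.avoids G a∈G

        bound : FilterAvoiding
        bound = record
          { member = λ a → Resize L (a ∈ Union)
          ; filter = record
            { ⊤-member = resize (G₀ , G₀∈C , G.⊤-member G₀)
            ; ∧-closed = λ x y → resize (union-∧ (unresize x) (unresize y))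
            ; upward   = λ a≤b x → resize (map₂ (λ {G} → map₂ (G.upward G a≤b)) (unresize x))
            }
          ; contains = λ a∈F → resize (G₀ , G₀∈C , G.contains G₀ a∈F)
          ; avoids   = union-avoids ∘ unresize
          }

      maximal-meets : ((M , _) : ∃ (IsMaximal filterPoset)) → ∀ {a} → ¬ (a ∈ G.member M) →
                      ∃ λ x → x ∈ G.member M × a ∧ x ∈ J
      maximal-meets (M , maximal) {a} a∉M = by-contradiction λ none →
        -- Maximality puts the whole extension inside `M`, and the extension contains `a`, with `⊤`
        -- as the witness from `M`.
        a∉M (proj₂ (maximal {extension none} M⊆extended) (⊤ , G.⊤-member M , lift (x∧y≤x a ⊤)))
        where
        -- The filter generated by `M` and `a`.
        Extended : Pred Carrier L
        Extended y = ∃ λ x → x ∈ G.member M × Lift ℓ₁ (a ∧ x ≤ y)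

        M⊆extended : G.member M ⊆ Extended
        M⊆extended {x} x∈M = x , x∈M , lift (x∧y≤y a x)

        extended-∧ : ∀ {y z} → y ∈ Extended → z ∈ Extended → y ∧ z ∈ Extended
        extended-∧ (x , x∈M , lift a∧x≤y) (x′ , x′∈M , lift a∧x′≤z) =
          x ∧ x′ , G.∧-closed M x∈M x′∈M ,
          lift (∧-greatest (trans (∧-monotonic refl (x∧y≤x x x′)) a∧x≤y)
                           (trans (∧-monotonic refl (x∧y≤y x x′)) a∧x′≤z))

        extension : ¬ (∃ λ x → x ∈ G.member M × a ∧ x ∈ J) → FilterAvoiding
        extension none = record
          { member = Extended
          ; filter = record
            { ⊤-member = M⊆extended (G.⊤-member M)
            ; ∧-closed = extended-∧
            ; upward   = λ y≤z (x , x∈M , lift a∧x≤y) → x , x∈M , lift (trans a∧x≤y y≤z)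
            }
          ; contains = λ y∈F → M⊆extended (G.contains M y∈F)
          ; avoids   = λ (x , x∈M , lift a∧x≤y) y∈J → none (x , x∈M , J.downward a∧x≤y y∈J)
          }

      -- If `a ∧ x` and `b ∧ y` lie in `J`, distributivity puts `(a ∨ b) ∧ (x ∧ y)` in `J` as well;
      -- were `a ∨ b` in `M`, this element would lie in `M` too.
      maximal-prime : ((M , _) : ∃ (IsMaximal filterPoset)) → ∀ {a b} → ¬ (a ∈ G.member M) →
                      ¬ (b ∈ G.member M) → ¬ (a ∨ b ∈ G.member M)
      maximal-prime maximal@(M , _) {a} {b} a∉M b∉M a∨b∈M
        with maximal-meets maximal a∉M | maximal-meets maximal b∉M
      ... | x , x∈M , a∧x∈J | y , y∈M , b∧y∈J =
        G.avoids M (G.∧-closed M a∨b∈M (G.∧-closed M x∈M y∈M))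
          (J.downward split (J.∨-closed a∧x∈J b∧y∈J))
        where
        split : (a ∨ b) ∧ (x ∧ y) ≤ (a ∧ x) ∨ (b ∧ y)
        split = trans (reflexive (∧-distribʳ-∨ (x ∧ y) a b))
                      (∨-monotonic (∧-monotonic refl (x∧y≤x x y)) (∧-monotonic refl (x∧y≤y x y)))

      -- The last component records maximality, which says more than primeness; it is what makes
      -- closure points respect entailment.
      primeFilterTheorem : ∃ λ (q : X) → F ⊆ member q × (∀ {a} → a ∈ member q → a ∉ J) ×
                           (∀ {a} → ¬ (a ∈ member q) → ∃ λ x → x ∈ member q × a ∧ x ∈ J)
      primeFilterTheorem with zornsLemma filterPoset chain-bounded
      ... | maximal@(M , _) = q , G.contains M , G.avoids M , maximal-meets maximal
        where
        q : X
        q = record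
          { member   = G.member M
          ; ⊤-member = G.⊤-member M
          ; ∧-closed = G.∧-closed M
          ; upward   = G.upward M
          ; proper   = λ ⊥∈M → G.avoids M ⊥∈M J.⊥-member
          ; prime    = λ a∨b∈M → by-contradiction λ neither →
              maximal-prime maximal (neither ∘ inj₁) (neither ∘ inj₂) a∨b∈M
          }

    -- Order and topology of the Priestley space.

    𝔰-reflects-≤ : ∀ {a b} → 𝔰 A a ⊆ 𝔰 A b → a ≤ b
    𝔰-reflects-≤ {a} {b} 𝔰a⊆𝔰b = by-contradiction λ a≰b →
      -- When `a ≰ b`, the filter above `a` misses the ideal below `b`, and a prime filter separates
      -- them.
      let q , contains , avoids , _ =
            primeFilterTheorem (principalFilter a) (principalIdeal b)
              (λ a≤x x≤b → a≰b (trans a≤x x≤b))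
      in avoids (𝔰a⊆𝔰b {q} (contains refl)) refl

    -- The preorder `a ⊳ b` over `C`; classically it says that `C` misses the basic open set
    -- `subbasic A (a , b)`.
    Entails : Pred X u → Carrier → Carrier → Set (suc L ⊔ u)
    Entails C a b = ∀ {r} → r ∈ C → a ∈ member r → b ∈ member r

    -- The subbase is already a base: the pairs `(a , b)` and `(a′ , b′)` intersect in
    -- `(a ∧ a′ , b ∨ b′)`, by primeness, and `(⊤ , ⊥)` gives the whole space.
    basic-neighbourhood : {V : Pred X v} → IsOpen A V → ∀ {p} → p ∈ V →
                          ∃ λ ab → p ∈ subbasic A ab × subbasic A ab ⊆ V
    basic-neighbourhood openV {p} p∈V with openV p∈V
    ... | js , p∈js , js⊆V = map₂ (map₂ λ ab⊆js {q} q∈ab → js⊆V (ab⊆js {q} q∈ab)) (intersection js p∈js)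
      where
      intersection : ∀ js → All (λ j → p ∈ subbasic A j) js →
                     ∃ λ ab → p ∈ subbasic A ab ×
                              (∀ {q} → q ∈ subbasic A ab → All (λ j → q ∈ subbasic A j) js)
      intersection [] [] = (⊤ , ⊥) , (⊤-member p , proper p) , λ _ → []
      intersection ((a , b) ∷ js) ((a∈p , b∉p) ∷ p∈js) with intersection js p∈js
      ... | (a′ , b′) , (a′∈p , b′∉p) , below =
        (a ∧ a′ , b ∨ b′) ,
        (∧-closed p a∈p a′∈p , [ b∉p , b′∉p ]′ ∘ prime p) ,
        λ {q} (a∧a′∈q , b∨b′∉q) →
          (upward q (x∧y≤x a a′) a∧a′∈q , b∨b′∉q ∘ upward q (x≤x∨y b b′)) ∷
          below {q} (upward q (x∧y≤y a a′) a∧a′∈q , b∨b′∉q ∘ upward q (y≤x∨y b b′))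

    subbasic-isOpen : ∀ ab → IsOpen A (subbasic A ab)
    subbasic-isOpen ab p∈ab = ab ∷ [] , p∈ab ∷ [] , λ { (q∈ab ∷ []) → q∈ab }

    𝔰-isClopen : ∀ a → IsClopen A (𝔰 A a)
    𝔰-isClopen a =
      -- The pair `(a , ⊥)` gives `𝔰 A a` since points are proper, and `(⊤ , a)` gives its
      -- complement.
      (λ {p} a∈p → (a , ⊥) ∷ [] , (a∈p , proper p) ∷ [] , λ { ((a∈q , _) ∷ []) → a∈q }) ,
      (λ {p} a∉p → (⊤ , a) ∷ [] , (⊤-member p , a∉p) ∷ [] , λ { ((_ , a∉q) ∷ []) → a∉q })

    IsClopen-resp-≐ : {U : Pred X u} {V : Pred X v} → U ≐ V → IsClopen A U → IsClopen A V
    IsClopen-resp-≐ (U⊆V , V⊆U) (openU , open∁U) =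
      GeneratedOpen-resp-≐ (U⊆V , V⊆U) openU ,
      GeneratedOpen-resp-≐ ((λ p∉U → p∉U ∘ V⊆U) , λ p∉V → p∉V ∘ U⊆V) open∁U

    -- A basic neighbourhood `(a , b)` of `q` missing `C` would mean `a ⊳ b`, with `a` in `q` and
    -- `b` outside.
    respects⇒cl : {C : Pred X u} (q : X) →
                  (∀ {a b} → Entails C a b → a ∈ member q → b ∈ member q) → q ∈ cl A C
    respects⇒cl q respects V openV q∈V with basic-neighbourhood openV {q} q∈V
    ... | (a , b) , (a∈q , b∉q) , ab⊆V = by-contradiction λ V∩C=∅ →
      b∉q (respects (λ {r} r∈C a∈r → by-contradiction λ b∉r →
        V∩C=∅ (r , ab⊆V (a∈r , b∉r) , r∈C)) a∈q)

    cl⇒respects : {C : Pred X u} (q : X) → q ∈ cl A C →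
                  ∀ {a b} → Entails C a b → a ∈ member q → b ∈ member q
    cl⇒respects q q∈clC {a} {b} a⊳b a∈q = by-contradiction λ b∉q →
      let r , (a∈r , b∉r) , r∈C =
            q∈clC (subbasic A (a , b)) (λ {p} → subbasic-isOpen (a , b) {p}) (a∈q , b∉q)
      in b∉r (a⊳b r∈C a∈r)

    ⊆-cl : (C : Pred X u) → C ⊆ cl A C
    ⊆-cl C {p} p∈C V openV p∈V = p , p∈V , p∈C

    cl-closed : {C : Pred X u} → IsOpen A (∁ C) → cl A C ⊆ C
    cl-closed open∁C {q} q∈clC = by-contradiction λ q∉C →
      let (a , b) , (a∈q , b∉q) , ab⊆∁C = basic-neighbourhood open∁C q∉C
      in b∉q (cl⇒respects q q∈clC
           (λ r∈C a∈r → by-contradiction λ b∉r → ab⊆∁C (a∈r , b∉r) r∈C) a∈q)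

    cl-mono : {C : Pred X u} {D : Pred X v} → C ⊆ D → cl A C ⊆ cl A D
    cl-mono C⊆D p∈clC V openV p∈V = map₂ (map₂ C⊆D) (p∈clC V openV p∈V)

    cl₂-mono : {C : Pred X u} {D : Pred X v} → C ⊆ D → cl₂ A C ⊆ cl₂ A D
    cl₂-mono C⊆D (q , q∈clC , q⊑p) = q , cl-mono C⊆D q∈clC , q⊑p

    ⊆-cl₂ : (U : Pred X u) → U ⊆ cl₂ A U
    ⊆-cl₂ U {p} p∈U = p , ⊆-cl U p∈U , id

    cl⊆cl₂ : (U : Pred X u) → cl A U ⊆ cl₂ A U
    cl⊆cl₂ U {p} p∈clU = p , p∈clU , id

    cl₂-isUpset : (U : Pred X u) → IsUpset A (cl₂ A U)
    cl₂-isUpset U p⊑q (r , r∈clU , r⊑p) = r , r∈clU , p⊑q ∘ r⊑p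

    -- The hypothesis yields `⊤ ⊳ n` over `U`, so every closure point contains `n`, and so does
    -- every point above it.
    cl₂⊆𝔰 : {U : Pred X u} → ∀ {n} → U ⊆ 𝔰 A n → cl₂ A U ⊆ 𝔰 A n
    cl₂⊆𝔰 U⊆𝔰n (q , q∈clU , q⊑p) =
      q⊑p (cl⇒respects q q∈clU (λ r∈U _ → U⊆𝔰n r∈U) (⊤-member q))

    -- Construction of closure points.

    module _ (C : Pred X u) {F : Pred Carrier f} {I : Pred Carrier i}
             (isFilter : IsFilter F) (isIdeal : IsIdeal I)
             (F⋫I : ∀ {x y} → x ∈ F → y ∈ I → ¬ Entails C x y) where
      private
        -- The down-closure of `I` under `⊳`; it is closed under joins because the points of `C` are
        -- prime.
        Lower : Pred Carrier (suc L ⊔ u ⊔ i)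
        Lower x = ∃ λ y → y ∈ I × Entails C x y

        lower-isIdeal : IsIdeal Lower
        lower-isIdeal = record
          { ⊥-member = ⊥ , IsIdeal.⊥-member isIdeal , λ _ → id
          ; ∨-closed = λ (y , y∈I , a⊳y) (z , z∈I , b⊳z) →
              y ∨ z , IsIdeal.∨-closed isIdeal y∈I z∈I ,
              λ {r} r∈C a∨b∈r →
                [ upward r (x≤x∨y y z) ∘ a⊳y r∈C
                , upward r (y≤x∨y y z) ∘ b⊳z r∈C ]′ (prime r a∨b∈r)
          ; downward = λ a≤b (y , y∈I , b⊳y) → y , y∈I , λ {r} r∈C → b⊳y r∈C ∘ upward r a≤b
          }

      abstract
        -- The source of the closure points below: `F` forces elements into `q` and `I` keeps
        -- elements out, provided that no entailment over `C` leads from `F` to `I`.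
        closure-point : ∃ λ q → q ∈ cl A C × F ⊆ member q × (∀ {a} → a ∈ member q → a ∉ I)
        closure-point
          with primeFilterTheorem isFilter lower-isIdeal (λ x∈F (y , y∈I , x⊳y) → F⋫I x∈F y∈I x⊳y)
        ... | q , F⊆q , avoids , meets =
          q , respects⇒cl q respects , F⊆q , λ {a} a∈q a∈I → avoids a∈q (a , a∈I , λ _ → id)
          where
          respects : ∀ {a b} → Entails C a b → a ∈ member q → b ∈ member q
          -- From `a ⊳ b` follows `a ∧ x ⊳ b ∧ x ⊳ y`, so `a ∧ x` would lie in `q` and in `Lower`.
          respects {a} {b} a⊳b a∈q = by-contradiction λ b∉q →
            let x , x∈q , y , y∈I , b∧x⊳y = meets b∉q
            in avoids (∧-closed q a∈q x∈q)
                 (y , y∈I , λ {r} r∈C a∧x∈r →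
                   b∧x⊳y r∈C (∧-closed r (a⊳b r∈C (upward r (x∧y≤x a x) a∧x∈r))
                                         (upward r (x∧y≤y a x) a∧x∈r)))

    -- Clopen upsets are represented by lattice elements.

    module _ {W : Pred X w} (clopenW : IsClopen A W) (upsetW : IsUpset A W) where

      abstract
        -- Over `∁ W`, `x ⊳ ⊥` means `𝔰 A x ⊆ W`. If no `x` in `p` satisfies this, some `q` above
        -- `p` lies in the closure of `∁ W`, hence outside `W` as `W` is open; but `W` is an upset.
        clopen-upset-interior : ∀ {p} → p ∈ W → ∃ λ a → a ∈ member p × 𝔰 A a ⊆ W
        clopen-upset-interior {p} p∈W = by-contradiction λ none →
          let q , q∈cl∁W , p⊑q , _ =
                closure-point (∁ W) (member-isFilter p) (principalIdeal ⊥)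
                  λ {x} x∈p y≤⊥ x⊳y → none (x , x∈p , λ {r} x∈r → by-contradiction λ r∉W →
                    proper r (upward r y≤⊥ (x⊳y r∉W x∈r)))
          in cl-closed (GeneratedOpen-resp-≐ ((λ r∈W r∉W → r∉W r∈W) , by-contradiction)
                         (proj₁ clopenW))
               q∈cl∁W (upsetW p⊑q p∈W)

      private
        inside-isIdeal : IsIdeal (λ a → 𝔰 A a ⊆ W)
        inside-isIdeal = record
          { ⊥-member = λ {r} ⊥∈r → contradiction ⊥∈r (proper r)
          ; ∨-closed = λ 𝔰a⊆W 𝔰b⊆W {r} a∨b∈r → [ 𝔰a⊆W , 𝔰b⊆W ]′ (prime r a∨b∈r)
          ; downward = λ a≤b 𝔰b⊆W {r} a∈r → 𝔰b⊆W (upward r a≤b a∈r)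
          }

      clopen-upset-𝔰 : ∃ λ a → W ≐ 𝔰 A a
      clopen-upset-𝔰 = by-contradiction contradict
        where
        contradict : ¬ ¬ (∃ λ a → W ≐ 𝔰 A a)
        contradict none
          -- Over `W`, `⊤ ⊳ y` means `W ⊆ 𝔰 A y`. If this fails for every `𝔰 A y` inside `W`, some
          -- point of `W` belongs to no such `𝔰 A y`, against the previous lemma.
          with closure-point W (principalFilter ⊤) inside-isIdeal
                 (λ {x} {y} ⊤≤x 𝔰y⊆W x⊳y →
                   none (y , (λ {r} r∈W → x⊳y r∈W (upward r ⊤≤x (⊤-member r))) , 𝔰y⊆W))
        ... | q , q∈clW , _ , avoids
          with clopen-upset-interior {q} (cl-closed {C = W} (proj₂ clopenW) {q} q∈clW)
        ... | a , a∈q , 𝔰a⊆W = avoids {a} a∈q 𝔰a⊆W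

    -- Joins and distributive joins as closures of unions.

    ⋃𝔰 : {I : Set i} → (I → Carrier) → Pred X (L ⊔ i)
    ⋃𝔰 {I = I} s = ⋃ I (λ i → 𝔰 A (s i))

    module _ {I : Set i} (s : I → Carrier) {m : Carrier} where

      join⇒cl₂≐𝔰 : IsJoin A s m → cl₂ A (⋃𝔰 s) ≐ 𝔰 A m
      join⇒cl₂≐𝔰 join =
        (λ {p} → cl₂⊆𝔰 (λ {r} (i , sᵢ∈r) → upward r (upper join i) sᵢ∈r) {p}) , λ {p} m∈p →
        -- The ideal is the complement of `p`, so that `q ⊑ p`. Over the union, `⊤ ⊳ y` makes `y` an
        -- upper bound of `s`; then `m ≤ y` puts `y` in `p`.
        let q , q∈cl , _ , q∩∁p=∅ =
              closure-point (⋃𝔰 s) (principalFilter ⊤) (nonmember-isIdeal p)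
                λ ⊤≤x y∉p x⊳y → y∉p (upward p (least join λ i →
                  𝔰-reflects-≤ λ {r} sᵢ∈r → x⊳y {r} (i , sᵢ∈r) (upward r ⊤≤x (⊤-member r))) m∈p)
        in q , q∈cl , λ a∈q → by-contradiction (q∩∁p=∅ a∈q)

      cl₂≐𝔰⇒join : cl₂ A (⋃𝔰 s) ≐ 𝔰 A m → IsJoin A s m
      cl₂≐𝔰⇒join (cl₂⊆ , ⊆cl₂) = record
        { upper = λ i → 𝔰-reflects-≤ λ {p} sᵢ∈p → cl₂⊆ {p} (⊆-cl₂ (⋃𝔰 s) {p} (i , sᵢ∈p))
        ; least = λ s≤n → 𝔰-reflects-≤ λ {p} m∈p →
            cl₂⊆𝔰 (λ {r} (i , sᵢ∈r) → upward r (s≤n i) sᵢ∈r) {p} (⊆cl₂ {p} m∈p)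
        }

      -- Over the union, `a ⊳ b` makes `b` an upper bound of all `a ∧ s i`, so `a ∧ m ≤ b`.
      distributive⇒𝔰⊆cl : IsDistributiveJoin A s m → 𝔰 A m ⊆ cl A (⋃𝔰 s)
      distributive⇒𝔰⊆cl distributive {p} m∈p = respects⇒cl p λ {a} {b} a⊳b a∈p →
        upward p
          (least (distributive a) λ i → 𝔰-reflects-≤ λ {r} a∧sᵢ∈r →
            a⊳b {r} (i , upward r (x∧y≤y a (s i)) a∧sᵢ∈r) (upward r (x∧y≤x a (s i)) a∧sᵢ∈r))
          (∧-closed p a∈p m∈p)

      𝔰⊆cl⇒distributive : IsJoin A s m → 𝔰 A m ⊆ cl A (⋃𝔰 s) → IsDistributiveJoin A s m
      𝔰⊆cl⇒distributive join 𝔰m⊆cl a = record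
        { upper = λ i → ∧-monotonic refl (upper join i)
        ; least = λ {n} a∧s≤n → 𝔰-reflects-≤ λ {p} a∧m∈p →
            cl⇒respects p (𝔰m⊆cl (upward p (x∧y≤y a m) a∧m∈p))
              (λ {r} (i , sᵢ∈r) a∈r → upward r (a∧s≤n i) (∧-closed r a∈r sᵢ∈r))
              (upward p (x∧y≤x a m) a∧m∈p)
        }

    -- The two implications.

    module _ {k : Level} (K : Set k) where

      JoinsDistributive : Set (c ⊔ ℓ₂ ⊔ suc k)
      JoinsDistributive = (I : Set k) → I ≺ K → (s : I → Carrier) (m : Carrier) →
                          IsJoin A s m → IsDistributiveJoin A s m

      ClosuresAgree : Set (suc (L ⊔ k))
      ClosuresAgree = (U : Pred X (L ⊔ k)) → IsκClopenUpset A K U →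
                      IsClopen A (cl₂ A U) → cl₂ A U ≐ cl A U

      joinsDistributive⇒closuresAgree : JoinsDistributive → ClosuresAgree
      joinsDistributive⇒closuresAgree distributive U κClopen clopen₂ =
        (λ {p} p∈cl₂U → cl-mono ⋃𝔰⊆U {p} (𝔰m⊆cl (proj₁ cl₂U≐𝔰m {p} p∈cl₂U))) , cl⊆cl₂ U
        where
        open IsκClopenUpset κClopen

        -- The witnesses form the family `s`; since `cl₂ A U` is also some `𝔰 A m`, this `m` is the
        -- join of `s`.
        piece-𝔰 : ∀ i → ∃ λ a → piece i ≐ 𝔰 A a
        piece-𝔰 i = clopen-upset-𝔰 (clopen i) (λ {p} {q} → upset i {p} {q})

        s : Index → Carrier
        s = proj₁ ∘ piece-𝔰

        U⊆⋃𝔰 : U ⊆ ⋃𝔰 s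
        U⊆⋃𝔰 = map₂ (λ {i} → proj₁ (proj₂ (piece-𝔰 i))) ∘ proj₁ isUnion

        ⋃𝔰⊆U : ⋃𝔰 s ⊆ U
        ⋃𝔰⊆U = proj₂ isUnion ∘ map₂ (λ {i} → proj₂ (proj₂ (piece-𝔰 i)))

        cl₂U-𝔰 : ∃ λ m → cl₂ A U ≐ 𝔰 A m
        cl₂U-𝔰 = clopen-upset-𝔰 clopen₂ (λ {p} {q} → cl₂-isUpset U {p} {q})

        m : Carrier
        m = proj₁ cl₂U-𝔰

        cl₂U≐𝔰m : cl₂ A U ≐ 𝔰 A m
        cl₂U≐𝔰m = proj₂ cl₂U-𝔰

        𝔰m⊆cl : 𝔰 A m ⊆ cl A (⋃𝔰 s)
        𝔰m⊆cl = distributive⇒𝔰⊆cl s (distributive Index small s m (cl₂≐𝔰⇒join s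
          ((λ {p} → proj₁ cl₂U≐𝔰m {p} ∘ cl₂-mono ⋃𝔰⊆U {p}) ,
           (λ {p} → cl₂-mono U⊆⋃𝔰 {p} ∘ proj₂ cl₂U≐𝔰m {p}))))

      -- The closure condition is applied to `⋃𝔰 s`, whose `cl₂` is the clopen set `𝔰 A m` because
      -- `m` is the join.
      closuresAgree⇒joinsDistributive : ClosuresAgree → JoinsDistributive
      closuresAgree⇒joinsDistributive agree I I≺K s m join =
        𝔰⊆cl⇒distributive s join
          (λ {p} → proj₁ (agree (⋃𝔰 s) κClopen clopen₂) {p} ∘ proj₂ cl₂≐𝔰m {p})
        where
        cl₂≐𝔰m : cl₂ A (⋃𝔰 s) ≐ 𝔰 A m
        cl₂≐𝔰m = join⇒cl₂≐𝔰 s join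

        clopen₂ : IsClopen A (cl₂ A (⋃𝔰 s))
        clopen₂ = IsClopen-resp-≐ ((λ {p} → proj₂ cl₂≐𝔰m {p}) , (λ {p} → proj₁ cl₂≐𝔰m {p})) (𝔰-isClopen m)

        κClopen : IsκClopenUpset A K (⋃𝔰 s)
        κClopen = record
          { Index   = I
          ; small   = I≺K
          ; piece   = λ i → 𝔰 A (s i)
          ; clopen  = λ i → 𝔰-isClopen (s i)
          ; upset   = λ i p⊑q → p⊑q
          ; isUnion = id , id
          }

theorem5p17 : ClassicalLogicWithChoice →
    {c ℓ₁ ℓ₂ k : Level} (A : BoundedDistributiveLattice c ℓ₁ ℓ₂) (K : Set k) →
    IsRegular K →
    ((I : Set k) → I ≺ K →
    (s : I → BoundedDistributiveLattice.Carrier A)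
    (m : BoundedDistributiveLattice.Carrier A) →
    IsJoin A s m → IsDistributiveJoin A s m)
    ⇔
    ((U : Pred (PrimeFilter A) (c ⊔ ℓ₁ ⊔ ℓ₂ ⊔ k)) → IsκClopenUpset A K U →
    IsClopen A (cl₂ A U) → cl₂ A U ≐ cl A U)
theorem5p17 classical A K regular =
  mk⇔ (joinsDistributive⇒closuresAgree classical A K) (closuresAgree⇒joinsDistributive classical A K)
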